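{- Let $V$ be a finite acyclic digraph whose nodes are coloured white or gray, let $n\ge 0$, and let $G=(V,x)$ with $x$ a gray node of $V$ be such that all options of $G$ have been assigned by step $n$ of the labelling procedure described in the context. Let $\mathcal C_{n+1}(G)=\{k\in\mathbb Z_{0}^{+} : \mathrm{Cr}(G,k)=\textsc{true}\}$. Then $\mathcal C_{n+1}(G)$ is either finite, or infinite of the form $\mathbb Z_{0}^{+}\setminus F$ where $F$ is finite. Moreover: (1) If there is at least one option $G'=(V,x')$ of $G$ with $x'$ gray such that $\mathcal C_n(G')$ is infinite, let $\mathbb Z_0^{+}\setminus F_1,\ldots,\mathbb Z_0^{+}\setminus F_j$ be the infinite sets among the sets $\mathcal C_n(G')$ of the gray options $G'$ of $G$ (with $F_1,\dots,F_j$ finite), and let $l=\max(F_1\cup\cdots\cup F_j)$ (with the convention $\max\emptyset=-1$). Then $\mathrm{Cr}(G,k)=\textsc{false}$ for all $k>l$ (with $k\in\mathbb Z_0^+$). (2) Otherwise, let $l$ be the least nonnegative integer exceeding all integers in $$\bigcup_{G'=(V,x'),\ x'\text{ gray}}\mathcal C_n(G')\ \cup\ \{\mathcal G_n(G') : G'=(V,x'),\ x'\text{ white}\},$$ where $G'$ ranges over the options of $G$. Then $\mathrm{Cr}(G,k)=\textsc{true}$ for all $k\ge l$.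
   Context: $\mathbb Z_0^{+}$ denotes the nonnegative integers. A game is a pair $G=(V,x)$ where $V$ is a finite digraph with white and gray nodes and $x$ is a node of $V$ (the location of a piece). The options of $G$ are the games $G'=(V,x')$ with an arc from $x$ to $x'$; an option is called white or gray according to the colour of $x'$. A node is terminal if it has no outgoing arcs. $\mathrm{mex}(S)$ is the least nonnegative integer not in $S$. Function Cr. For an integer $k\ge 0$ and $G=(V,x)$ with $x$ gray and with all options already assigned by step $n$: if $x$ is terminal, $\mathrm{Cr}(G,k)=\textsc{true}$. If $x$ is not terminal, $\mathrm{Cr}(G,k)=\textsc{true}$ if every white option $G'$ of $G$ satisfies $\mathcal G_n(G')\neq k$ and every gray option $G'$ of $G$ satisfies $\mathrm{Cr}(G',k)=\textsc{false}$; otherwise $\mathrm{Cr}(G,k)=\textsc{false}$. Labelling procedure (acyclic impartial games with entailing moves). White nodes receive values $\mathcal G_n(G)\in\mathbb Z_0^+\cup\{\mathrm{Moon},\infty\}$, where $\mathrm{Moon}$ is a special non-integer symbol, and gray nodes receive values $\mathcal C_n(G)$ that are subsets of $\mathbb Z_0^+$ or the symbol $\infty$; $\infty$ means "not assigned yet". Step 0: $\mathcal G_0(G)=0$ if $x$ is white and terminal, $\mathcal G_0(G)=\infty$ if $x$ is white and not terminal; $\mathcal C_0(G)=\mathbb Z_0^+$ if $x$ is gray and terminal, $\mathcal C_0(G)=\infty$ if $x$ is gray and not terminal. Step $n+1$: if $x$ is white and all options of $G=(V,x)$ are assigned, let $D=\{\mathcal G_n(G'): G'\text{ white option}\}$ and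 $P=\bigcup_{G'\text{ gray option}}\mathcal C_n(G')$; put $\mathcal G_{n+1}(G)=\mathrm{Moon}$ if $\mathbb Z_0^+\subseteq D\cup P$, and $\mathcal G_{n+1}(G)=\mathrm{mex}(D\cup P)$ otherwise. If $x$ is gray and all options of $G=(V,x)$ are assigned, put $\mathcal C_{n+1}(G)=\{k\in\mathbb Z_0^+:\mathrm{Cr}(G,k)=\textsc{true}\}$. All other nodes keep their value. -}

module Defs where

open import Data.Bool.Base using (Bool; true; false; not)
open import Data.Bool.ListAction using (all)
open import Data.Empty using (⊥)
open import Data.Fin.Base using (Fin)
open import Data.Fin.Induction using (spo-noetherian)
open import Data.Integer.Base using (ℤ; +_; -1ℤ)
open import Data.List.Base using (List; allFin)
open import Data.List.Membership.Propositional using (_∈_; _∉_)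
open import Data.Nat.Base using (ℕ; suc; _≤_; _<_)
open import Data.Nat.Properties using (_≟_)
open import Data.Product.Base using (∃; _×_)
open import Data.Sum.Base using (_⊎_)
open import Function.Base using (flip)
open import Induction.WellFounded using (Acc; acc; WellFounded)
open import Level using (0ℓ)
open import Relation.Binary.Core using (Rel)
open import Relation.Binary.Definitions using (Decidable)
open import Relation.Binary.Structures using (IsStrictPartialOrder)
open import Relation.Binary.Construct.Closure.Transitive
  using (TransClosure; [_]; transitive)
open import Relation.Binary.PropositionalEquality
  using (_≡_; _≢_; refl; resp₂; isEquivalence)
open import Relation.Nullary using (¬_; Dec; yes; no; does)
open import Relation.Unary using (Pred; _≐_; ∁; Empty; U)

Finite : Pred ℕ 0ℓ → Set
Finite S = ∃ λ (L : List ℕ) → S ≐ (_∈ L)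

Infinite : Pred ℕ 0ℓ → Set
Infinite S = ¬ Finite S

Cofinite : Pred ℕ 0ℓ → Set
Cofinite S = ∃ λ (F : List ℕ) → S ≐ (_∉ F)

IsLeast : Pred ℕ 0ℓ → Pred ℕ 0ℓ
IsLeast S m = S m × (∀ j → S j → m ≤ j)

IsMex : Pred ℕ 0ℓ → Pred ℕ 0ℓ
IsMex S = IsLeast (∁ S)

IsLeastExceeding : Pred ℕ 0ℓ → Pred ℕ 0ℓ
IsLeastExceeding S = IsLeast (λ m → ∀ j → S j → j < m)

data IsMax (S : Pred ℕ 0ℓ) : ℤ → Set where
  empty    : Empty S → IsMax S -1ℤ
  attained : ∀ {m} → S m → (∀ j → S j → j ≤ m) → IsMax S (+ m)

data Colour : Set where
  white gray : Colour

record AcyclicDigraph : Set₁ where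
  infix 4 _⟶_ _⟶?_
  field
    order   : ℕ
    _⟶_     : Rel (Fin order) 0ℓ
    _⟶?_    : Decidable _⟶_
    acyclic : ∀ x → ¬ TransClosure _⟶_ x x
    colour  : Fin order → Colour

  Node : Set
  Node = Fin order

  Terminal : Pred Node 0ℓ
  Terminal x = ∀ y → ¬ (x ⟶ y)

  WhiteOption GrayOption : Rel Node 0ℓ
  WhiteOption x y = x ⟶ y × colour y ≡ white
  GrayOption  x y = x ⟶ y × colour y ≡ gray

  options-wellFounded : WellFounded (flip _⟶_)
  options-wellFounded x = unplus (spo-noetherian isSPO x)
    where
    isSPO : IsStrictPartialOrder _≡_ (TransClosure _⟶_)
    isSPO = record
      { isEquivalence = isEquivalence
      ; irrefl        = λ { refl → acyclic _ }
      ; trans         = transitive _⟶_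
      ; <-resp-≈      = resp₂ (TransClosure _⟶_)
      }

    unplus : ∀ {y} → Acc (flip (TransClosure _⟶_)) y → Acc (flip _⟶_) y
    unplus (acc rs) = acc λ a → unplus (rs [ a ])

data WhiteLabel : Set where
  val  : ℕ → WhiteLabel
  Moon : WhiteLabel
  ∞    : WhiteLabel

data GrayLabel : Set₁ where
  set : Pred ℕ 0ℓ → GrayLabel
  ∞   : GrayLabel

members : GrayLabel → Pred ℕ 0ℓ
members (set S) k = S k
members ∞       k = ⊥

hasValue : WhiteLabel → ℕ → Bool
hasValue (val j) k = does (j ≟ k)
hasValue Moon    k = false
hasValue ∞       k = false

module _ (V : AcyclicDigraph) where
  open AcyclicDigraph V

  -- Recursion along arcs. A terminal node gets `true`: the conjunction over
  -- its options is empty.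
  mutual
    crAcc : (Node → WhiteLabel) → ∀ x → Acc (flip _⟶_) x → ℕ → Bool
    crAcc g x (acc rs) k = all (λ y → crOption g y (x ⟶? y) rs (colour y) k) (allFin order)

    crOption : (Node → WhiteLabel) → ∀ {x} y → Dec (x ⟶ y) →
               (∀ {z} → x ⟶ z → Acc (flip _⟶_) z) → Colour → ℕ → Bool
    crOption g y (no  _) rs _     k = true
    crOption g y (yes a) rs white k = not (hasValue (g y) k)
    crOption g y (yes a) rs gray  k = not (crAcc g y (rs a) k)

-- The labels at one step. 𝒢 is meaningful on white nodes only, and 𝒞 on gray
-- nodes only; their other values are never used nor constrained.
record State (V : AcyclicDigraph) : Set₁ where
  open AcyclicDigraph V
  field
    𝒢 : Node → WhiteLabel
    𝒞 : Node → GrayLabel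

  Cr : Node → ℕ → Bool
  Cr x = crAcc V 𝒢 x (options-wellFounded x)

  CrTrue : Node → Pred ℕ 0ℓ
  CrTrue x k = Cr x k ≡ true

  Assigned : Node → Set₁
  Assigned x = (colour x ≡ white → 𝒢 x ≢ ∞) × (colour x ≡ gray → 𝒞 x ≢ ∞)

  OptionsAssigned : Node → Set₁
  OptionsAssigned x = ∀ y → x ⟶ y → Assigned y

  -- The integers in D ∪ P; D may also contain Moon.
  OptionNumbers : Node → Pred ℕ 0ℓ
  OptionNumbers x k = (∃ λ y → WhiteOption x y × 𝒢 y ≡ val k)
                    ⊎ (∃ λ y → GrayOption x y × members (𝒞 y) k)

  InfiniteGrayOption : Node → Pred Node 0ℓ
  InfiniteGrayOption x y = GrayOption x y × Infinite (members (𝒞 y))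

data WhiteRule (S : Pred ℕ 0ℓ) : WhiteLabel → Set where
  moon : (∀ k → S k) → WhiteRule S Moon
  mex  : ∀ {m} → IsMex S m → WhiteRule S (val m)

module _ {V : AcyclicDigraph} where
  open AcyclicDigraph V

  record Initial (s : State V) : Set₁ where
    open State s
    field
      white-terminal    : ∀ x → colour x ≡ white → Terminal x → 𝒢 x ≡ val 0
      white-nonterminal : ∀ x → colour x ≡ white → ¬ Terminal x → 𝒢 x ≡ ∞
      gray-terminal     : ∀ x → colour x ≡ gray → Terminal x → 𝒞 x ≡ set U
      gray-nonterminal  : ∀ x → colour x ≡ gray → ¬ Terminal x → 𝒞 x ≡ ∞

  -- The step is a relation rather than a function because it is not decidable
  -- whether an arbitrary D ∪ P is all of ℕ.
  record Step (s t : State V) : Set₁ where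
    open State s
    open State t using () renaming (𝒢 to 𝒢′; 𝒞 to 𝒞′)
    field
      white-assign : ∀ x → colour x ≡ white → OptionsAssigned x →
                     WhiteRule (OptionNumbers x) (𝒢′ x)
      white-keep   : ∀ x → colour x ≡ white → ¬ OptionsAssigned x → 𝒢′ x ≡ 𝒢 x
      gray-assign  : ∀ x → colour x ≡ gray → OptionsAssigned x →
                     𝒞′ x ≡ set (CrTrue x)
      gray-keep    : ∀ x → colour x ≡ gray → ¬ OptionsAssigned x → 𝒞′ x ≡ 𝒞 x

  record IsLabelling (s : ℕ → State V) : Set₁ where
    field
      initial : Initial (s 0)
      step    : ∀ n → Step (s n) (s (suc n))

{-# OPTIONS --safe #-}
module Submission where

-- Once a node is assigned its label never changes, since the labels it was computed from do
-- not change either. Hence at every step the labels of the assigned nodes satisfy the labelling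
-- rules with respect to the current labels, and 𝒞 y = { k : Cr y k } for every assigned gray y.
-- On the other hand Cr y k depends on k only through the tests 𝒢 z = k for white z, all of
-- which fail for k ≥ N, where N exceeds every number occurring in 𝒢. So each Cr y is constant
-- from N on, which makes { k : Cr y k } finite or cofinite according to the value Cr y N.

open import Defs
open import Data.Bool.Base using (T; false; true; not)
open import Data.Bool.ListAction using (and)
open import Data.Bool.Properties using (T-≡; T-not-≡; ¬-not)
  renaming (_≟_ to _≟ᵇ_)
open import Data.Fin.Properties using (all?; any?)
open import Data.Integer.Base using (ℤ; +_; -1ℤ; +<+) renaming (_<_ to _<ℤ_)
open import Data.List.Base using (allFin; filter; map; upTo)
open import Data.List.Extrema.Nat using (max; xs≤max)
open import Data.List.Membership.Propositional.Properties
  using (∈-allFin; ∈-filter⁺; ∈-filter⁻; ∈-map⁺; ∈-upTo⁺)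
open import Data.List.Properties using (map-cong)
import Data.List.Relation.Unary.All as All
open import Data.List.Relation.Unary.All.Properties using (all⁺; all⁻)
open import Data.Nat.Base using (ℕ; zero; suc; _≤_; _<_; z≤n; s≤s)
open import Data.Nat.Properties
  using (_≟_; _<?_; ≡ᵇ⇒≡; ≰⇒>; n≤1+n; ≤-antisym; ≤-refl; ≤-reflexive; ≤-trans; n≮n; <⇒≱; ≮⇒≥;
         m<1+n⇒m≤n; m≤n⇒m<n∨m≡n; m≤m⊔n; m≤n⊔m)
open import Data.Product.Base using (∃; _×_; _,_; proj₁; proj₂)
open import Data.Sum.Base using (_⊎_; inj₁; inj₂; [_,_])
open import Data.Unit.Base using (tt)
open import Function.Base using (flip; id; _∘_)
open import Function.Bundles using (Equivalence)
open import Induction.WellFounded using (Acc; acc)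
open import Level using (Level; 0ℓ)
open import Relation.Binary.PropositionalEquality
  using (_≡_; _≢_; refl; sym; trans; cong; subst)
open import Relation.Nullary using (¬_; Dec; yes; no; contradiction)
open import Relation.Nullary.Decidable
  using (dec-true; map′; ¬?; _×-dec_; _⊎-dec_; _→-dec_; decidable-stable)
open import Relation.Unary using (Pred; Decidable; Empty; _≐_; U)

private
  variable
    ℓ : Level
    S R : Pred ℕ 0ℓ

infix 1 _×-dec′_

-- The second decision may use a proof of the first component. Membership in `𝒞 y`, for instance, is
-- decided only once `y` is known to be a gray option of a node whose options are assigned.
_×-dec′_ : {A B : Set} → Dec A → (A → Dec B) → Dec (A × B)
no ¬a ×-dec′ b? = no (¬a ∘ proj₁)
yes a ×-dec′ b? = map′ (a ,_) proj₂ (b? a)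

false≢true : ∀ {b} → b ≡ false → b ≢ true
false≢true refl ()

-- Subsets of ℕ

bounded⇒finite : Decidable S → ∀ N → (∀ {k} → S k → k < N) → Finite S
bounded⇒finite S? N bound =
  filter S? (upTo N)
  , (λ sk → ∈-filter⁺ S? (∈-upTo⁺ (bound sk)) sk)
  , (λ k∈ → proj₂ (∈-filter⁻ S? {xs = upTo N} k∈))

cobounded⇒cofinite : Decidable S → ∀ N → (∀ {k} → N ≤ k → S k) → Cofinite S
cobounded⇒cofinite S? N all-large with bounded⇒finite (¬? ∘ S?) N (λ ¬sk → ≰⇒> (¬sk ∘ all-large))
... | F , ⊆F , F⊆ =
  F , (λ sk k∈F → F⊆ k∈F sk) , (λ {k} k∉F → decidable-stable (S? k) (k∉F ∘ ⊆F))

cobounded⇒infinite : ∀ N → (∀ {k} → N ≤ k → S k) → Infinite S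
cobounded⇒infinite N all-large (L , S⊆L , _) =
  -- The member of `S` is the inferred number `suc (N ⊔ max 0 L)`: it is at least `N`, yet exceeds
  -- every entry of `L`.
  n≮n _ (≤-trans (All.lookup (xs≤max 0 L) (S⊆L (all-large (≤-trans (m≤m⊔n N _) (n≤1+n _)))))
                 (m≤n⊔m N (max 0 L)))

Greatest : Pred ℕ 0ℓ → Pred ℕ 0ℓ
Greatest S m = S m × (∀ j → S j → j ≤ m)

-- Downward search from the bound. Both extremal numbers of the theorem, the maximum and the least
-- exceeding number, are read off this alternative.
empty⊎greatest : Decidable S → ∀ N → (∀ {k} → S k → k < N) → Empty S ⊎ ∃ (Greatest S)
empty⊎greatest S? zero    bound = inj₁ λ _ sk → contradiction (bound sk) λ ()
empty⊎greatest S? (suc N) bound with S? N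
... | yes sN = inj₂ (N , sN , λ _ sk → m<1+n⇒m≤n (bound sk))
... | no ¬sN = empty⊎greatest S? N λ sk →
  [ id , (λ { refl → contradiction sk ¬sN }) ] (m≤n⇒m<n∨m≡n (m<1+n⇒m≤n (bound sk)))

max-exists : Empty S ⊎ ∃ (Greatest S) → ∃ λ l → IsMax S l × (∀ k → l <ℤ + k → ¬ S k)
max-exists (inj₁ none)          = -1ℤ , empty none , λ k _ → none k
max-exists (inj₂ (m , sm , ub)) =
  + m , attained sm ub , λ { k (+<+ m<k) sk → <⇒≱ m<k (ub k sk) }

leastExceeding-exists : Empty S ⊎ ∃ (Greatest S) → ∃ (IsLeastExceeding S)
leastExceeding-exists (inj₁ none)          = 0 , (λ j sj → contradiction sj (none j)) , λ _ _ → z≤n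
leastExceeding-exists (inj₂ (m , sm , ub)) = suc m , (λ j sj → s≤s (ub j sj)) , λ j exc → exc m sm

-- Labels

assigned-value? : (w : WhiteLabel) → Dec (w ≢ ∞)
assigned-value? (val _) = yes λ ()
assigned-value? Moon    = yes λ ()
assigned-value? ∞       = no λ ∞≢∞ → ∞≢∞ refl

assigned-set? : (C : GrayLabel) → Dec (C ≢ ∞)
assigned-set? (set _) = yes λ ()
assigned-set? ∞       = no λ ∞≢∞ → ∞≢∞ refl

hasValue-val : ∀ {w k} → w ≡ val k → hasValue w k ≡ true
hasValue-val {k = k} refl = dec-true (k ≟ k) refl

hasValue-true : ∀ w {k} → hasValue w k ≡ true → w ≡ val k
hasValue-true (val j) {k} eq = cong val (≡ᵇ⇒≡ j k (Equivalence.from T-≡ eq))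

hasValue-dec : ∀ w k → Dec (w ≡ val k)
hasValue-dec w k = map′ (hasValue-true w) hasValue-val (hasValue w k ≟ᵇ true)

-- `Moon` and `∞` contribute no integer, so 0 is harmless in the maximum taken later.
strictBound : WhiteLabel → ℕ
strictBound (val m) = suc m
strictBound Moon    = 0
strictBound ∞       = 0

IsMex-unique : ∀ {m n} → IsMex S m → IsMex S n → m ≡ n
IsMex-unique (m∉ , m-least) (n∉ , n-least) = ≤-antisym (m-least _ n∉) (n-least _ m∉)

-- `Step` only relates labels, so this uniqueness is what shows that recomputing a white label
-- returns the old one.
WhiteRule-unique : ∀ {v w} → WhiteRule S v → WhiteRule S w → v ≡ w
WhiteRule-unique (moon _)          (moon _)          = refl
WhiteRule-unique (moon all)        (mex (m∉ , _))    = contradiction (all _) m∉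
WhiteRule-unique (mex (m∉ , _))    (moon all)        = contradiction (all _) m∉
WhiteRule-unique (mex p)           (mex q)           = cong val (IsMex-unique p q)

WhiteRule-resp : S ≐ R → ∀ {w} → WhiteRule S w → WhiteRule R w
WhiteRule-resp (S⊆R , _)   (moon all)         = moon λ k → S⊆R (all k)
WhiteRule-resp (S⊆R , R⊆S) (mex (m∉ , least)) = mex (m∉ ∘ R⊆S , λ j j∉ → least j (j∉ ∘ S⊆R))

WhiteRule-assigned : ∀ {w} → WhiteRule S w → w ≢ ∞
WhiteRule-assigned (moon _) ()
WhiteRule-assigned (mex _)  ()

_≟ᶜ_ : (c d : Colour) → Dec (c ≡ d)
white ≟ᶜ white = yes refl
white ≟ᶜ gray  = no λ ()
gray  ≟ᶜ white = no λ ()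
gray  ≟ᶜ gray  = yes refl

module _ {V : AcyclicDigraph} where
  open AcyclicDigraph V

  Terminal? : Decidable Terminal
  Terminal? x = all? λ y → ¬? (x ⟶? y)

  WhiteOption? : ∀ x y → Dec (WhiteOption x y)
  WhiteOption? x y = (x ⟶? y) ×-dec (colour y ≟ᶜ white)

  GrayOption? : ∀ x y → Dec (GrayOption x y)
  GrayOption? x y = (x ⟶? y) ×-dec (colour y ≟ᶜ gray)

  -- The function Cr

  module _ {g h : Node → WhiteLabel} {j k : ℕ} (P : Pred Node ℓ)
           (white-agree : ∀ {x y} → P x → WhiteOption x y → hasValue (g y) j ≡ hasValue (h y) k)
           (gray-closed : ∀ {x y} → P x → GrayOption x y → P y) where

    -- Labels, numbers and accessibility proofs vary together so that one induction covers three
    -- uses: independence of the accessibility proof, constancy for large numbers, and stability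
    -- under a step. `P` confines the agreement of labels to nodes where it is known.
    crAcc-cong : ∀ x (a b : Acc (flip _⟶_) x) → P x → crAcc V g x a j ≡ crAcc V h x b k
    -- The decision and the colour are abstracted so that `crOption` reduces on matching; the
    -- equation retains the link to `colour y`.
    crOption-cong : ∀ {x} y (d : Dec (x ⟶ y)) (as bs : ∀ {z} → x ⟶ z → Acc (flip _⟶_) z)
                    (c : Colour) → colour y ≡ c → P x →
                    crOption V g y d as c j ≡ crOption V h y d bs c k

    crAcc-cong x (acc as) (acc bs) px = cong and
      (map-cong (λ y → crOption-cong y (x ⟶? y) as bs (colour y) refl px) (allFin order))

    crOption-cong y (no _)  as bs c     eq px = refl
    crOption-cong y (yes a) as bs white eq px = cong not (white-agree px (a , eq))
    crOption-cong y (yes a) as bs gray  eq px =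
      cong not (crAcc-cong y (as a) (bs a) (gray-closed px (a , eq)))

  crAcc-irrelevant : ∀ g x (a b : Acc (flip _⟶_) x) k → crAcc V g x a k ≡ crAcc V g x b k
  crAcc-irrelevant g x a b k = crAcc-cong U (λ _ _ → refl) (λ _ _ → _) x a b _

  crAcc-gray : ∀ g x (a : Acc (flip _⟶_) x) {y} (b : Acc (flip _⟶_) y) {k} →
               crAcc V g x a k ≡ true → GrayOption x y → crAcc V g y b k ≡ false
  crAcc-gray g x (acc rs) {y} b {k} cr (arc , is-gray) =
    option (x ⟶? y) (colour y) is-gray
      (All.lookup (all⁺ _ (allFin order) (Equivalence.from T-≡ cr)) (∈-allFin y))
    where
    option : ∀ d c → c ≡ gray → T (crOption V g y d rs c k) → crAcc V g y b k ≡ false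
    option (no ¬arc) _    _ _ = contradiction arc ¬arc
    option (yes a)   gray _ t =
      trans (crAcc-irrelevant g y b (rs a) k) (Equivalence.to T-not-≡ t)

  crAcc-intro : ∀ g x (a : Acc (flip _⟶_) x) (bs : ∀ y → Acc (flip _⟶_) y) {k} →
                (∀ {y} → WhiteOption x y → hasValue (g y) k ≡ false) →
                (∀ {y} → GrayOption x y → crAcc V g y (bs y) k ≡ false) →
                crAcc V g x a k ≡ true
  crAcc-intro g x (acc rs) bs {k} whites grays =
    Equivalence.to T-≡ (all⁻ _ (All.tabulate {xs = allFin order} λ {y} _ →
      option y (x ⟶? y) (colour y) refl))
    where
    option : ∀ y d c → colour y ≡ c → T (crOption V g y d rs c k)
    option y (no _)  _     _  = tt
    option y (yes a) white eq = Equivalence.from T-not-≡ (whites (a , eq))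
    option y (yes a) gray  eq = Equivalence.from T-not-≡
      (trans (crAcc-irrelevant g y (rs a) (bs y) k) (grays (a , eq)))

  -- `Cr` at a fixed state, and its values at large numbers.

  module _ (s : State V) where
    open State s

    Cr-gray : ∀ {x y k} → CrTrue x k → GrayOption x y → Cr y k ≡ false
    Cr-gray {x} {y} = crAcc-gray 𝒢 x (options-wellFounded x) (options-wellFounded y)

    Cr-intro : ∀ {x k} → (∀ {y} → WhiteOption x y → hasValue (𝒢 y) k ≡ false) →
               (∀ {y} → GrayOption x y → Cr y k ≡ false) → CrTrue x k
    Cr-intro {x} = crAcc-intro 𝒢 x (options-wellFounded x) options-wellFounded

    CrTrue? : ∀ x → Decidable (CrTrue x)
    CrTrue? x k = Cr x k ≟ᵇ true

    -- One bound for all nodes, so that the same number works at every depth of the recursion of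
    -- `Cr`.
    threshold : ℕ
    threshold = max 0 (map (strictBound ∘ 𝒢) (allFin order))

    value<threshold : ∀ {y k} → 𝒢 y ≡ val k → k < threshold
    value<threshold {y} eq = ≤-trans (≤-reflexive (sym (cong strictBound eq)))
      (All.lookup (xs≤max 0 _) (∈-map⁺ (strictBound ∘ 𝒢) (∈-allFin y)))

    no-large-value : ∀ y {k} → threshold ≤ k → hasValue (𝒢 y) k ≡ false
    no-large-value y large =
      ¬-not λ has → <⇒≱ (value<threshold (hasValue-true (𝒢 y) has)) large

    Cr-eventually-constant : ∀ y {k} → threshold ≤ k → Cr y k ≡ Cr y threshold
    Cr-eventually-constant y large =
      crAcc-cong U (λ {_} {z} _ _ → trans (no-large-value z large)
                                          (sym (no-large-value z ≤-refl)))
        (λ _ _ → _) y (options-wellFounded y) (options-wellFounded y) _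

    eventually-true : ∀ y → CrTrue y threshold → ∀ {k} → threshold ≤ k → CrTrue y k
    eventually-true y tail large = trans (Cr-eventually-constant y large) tail

    eventually-false : ∀ y → ¬ CrTrue y threshold → ∀ {k} → CrTrue y k → k < threshold
    eventually-false y ¬tail {k} cr with k <? threshold
    ... | yes small = small
    ... | no ¬small =
      contradiction (trans (sym (Cr-eventually-constant y (≮⇒≥ ¬small))) cr) ¬tail

    CrTrue-finite⊎cofinite :
      ∀ y → Finite (CrTrue y) ⊎ (Infinite (CrTrue y) × Cofinite (CrTrue y))
    CrTrue-finite⊎cofinite y with CrTrue? y threshold
    ... | no ¬tail = inj₁ (bounded⇒finite (CrTrue? y) threshold (eventually-false y ¬tail))
    ... | yes tail = inj₂
      ( cobounded⇒infinite threshold (eventually-true y tail)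
      , cobounded⇒cofinite (CrTrue? y) threshold (eventually-true y tail))

    -- Consistency of the labels

    Assigned? : ∀ x → Dec (Assigned x)
    Assigned? x = ((colour x ≟ᶜ white) →-dec assigned-value? (𝒢 x))
            ×-dec ((colour x ≟ᶜ gray)  →-dec assigned-set? (𝒞 x))

    OptionsAssigned? : ∀ x → Dec (OptionsAssigned x)
    OptionsAssigned? x = all? λ y → (x ⟶? y) →-dec Assigned? y

    white-assigned : ∀ {x} → colour x ≡ white → 𝒢 x ≢ ∞ → Assigned x
    white-assigned w ≢∞ = (λ _ → ≢∞) , λ g → contradiction (trans (sym w) g) λ ()

    gray-assigned : ∀ {x} → colour x ≡ gray → 𝒞 x ≢ ∞ → Assigned x
    gray-assigned g ≢∞ = (λ w → contradiction (trans (sym w) g) λ ()) , λ _ → ≢∞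

    -- The invariant of the labelling. Gray labels are compared by `≐`: the stored predicate is
    -- built from the labels of an earlier step, whereas `CrTrue` here uses the current ones.
    record Consistent : Set₁ where
      field
        closed       : ∀ {x} → Assigned x → OptionsAssigned x
        white-rule   : ∀ {x} → colour x ≡ white → Assigned x → WhiteRule (OptionNumbers x) (𝒢 x)
        gray-members : ∀ {x} → colour x ≡ gray → Assigned x → members (𝒞 x) ≐ CrTrue x

  members-set : ∀ {C} → C ≡ set S → members C ≐ S
  members-set refl = id , id

  set-assigned : ∀ {C} → C ≡ set S → C ≢ ∞
  set-assigned refl ()

  by-colour : {P : Pred Node ℓ} → ∀ x → (colour x ≡ white → P x) → (colour x ≡ gray → P x) → P x
  by-colour x w g with colour x in eq
  ... | white = w refl
  ... | gray  = g refl

  -- At step 0 only terminal nodes are assigned, so conditions on options are vacuous: 0 is the mex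
  -- of the empty set, and `Cr` holds at every number.
  initial-consistent : ∀ {s} → Initial s → Consistent s
  initial-consistent {s} init = record
    { closed       = λ as y arc → contradiction arc (terminal as y)
    ; white-rule   = λ {x} w as → subst (WhiteRule _) (sym (white-terminal x w (terminal as)))
        (mex ( [ (λ { (y , (arc , _) , _) → terminal as y arc })
               , (λ { (y , (arc , _) , _) → terminal as y arc }) ]
             , λ _ _ → z≤n))
    ; gray-members = λ {x} g as →
          (λ _ → Cr-intro s (λ { {y} (arc , _) → contradiction arc (terminal as y) })
                            (λ { {y} (arc , _) → contradiction arc (terminal as y) }))
        , (λ _ → proj₂ (members-set (gray-terminal x g (terminal as))) _)
    }
    where
    open State s
    open Initial init

    terminal : ∀ {x} → Assigned x → Terminal x
    terminal {x} (w≢∞ , g≢∞) with Terminal? x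
    ... | yes t = t
    ... | no ¬t = by-colour {P = Terminal} x
      (λ w → contradiction (white-nonterminal x w ¬t) (w≢∞ w))
      (λ g → contradiction (gray-nonterminal x g ¬t) (g≢∞ g))

  -- Stability of labels under one step.

  module _ {s t : State V} (step : Step s t) where
    open State s
    open State t using () renaming
      (𝒢 to 𝒢′; 𝒞 to 𝒞′; Assigned to Assigned′; OptionsAssigned to OptionsAssigned′;
       OptionNumbers to OptionNumbers′; CrTrue to CrTrue′)
    open Step step

    assigned-next : ∀ {x} → OptionsAssigned x → Assigned′ x
    assigned-next {x} os = by-colour {P = Assigned′} x
      (λ w → white-assigned t w (WhiteRule-assigned (white-assign x w os)))
      (λ g → gray-assigned t g (set-assigned (gray-assign x g os)))

    module _ (consistent : Consistent s) where
      open Consistent consistent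

      -- By `closed` the step computes the label afresh, from the same option numbers that the old
      -- label already satisfies the rule for.
      𝒢-stable : ∀ {x} → colour x ≡ white → Assigned x → 𝒢 x ≡ 𝒢′ x
      𝒢-stable {x} w as = WhiteRule-unique (white-rule w as) (white-assign x w (closed as))

      𝒞-stable : ∀ {x} → colour x ≡ gray → Assigned x → members (𝒞 x) ≐ members (𝒞′ x)
      𝒞-stable {x} g as with gray-members g as | members-set (gray-assign x g (closed as))
      ... | to , from | to′ , from′ = (λ m → from′ (to m)) , λ m → from (to′ m)

      OptionNumbers-stable : ∀ {x} → OptionsAssigned x → OptionNumbers x ≐ OptionNumbers′ x
      OptionNumbers-stable os =
          (λ { (inj₁ (y , o@(arc , w) , eq)) →
                 inj₁ (y , o , trans (sym (𝒢-stable w (os y arc))) eq)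
             ; (inj₂ (y , o@(arc , g) , m)) → inj₂ (y , o , proj₁ (𝒞-stable g (os y arc)) m) })
        , (λ { (inj₁ (y , o@(arc , w) , eq)) →
                 inj₁ (y , o , trans (𝒢-stable w (os y arc)) eq)
             ; (inj₂ (y , o@(arc , g) , m)) → inj₂ (y , o , proj₂ (𝒞-stable g (os y arc)) m) })

      -- The recursion visits only nodes whose options are assigned, since `closed` passes this
      -- property down to gray options; there the white labels read are stable.
      Cr-stable : ∀ {x} k → OptionsAssigned x → Cr x k ≡ State.Cr t x k
      Cr-stable {x} k = crAcc-cong OptionsAssigned
        (λ { {_} {y} os (arc , w) → cong (λ v → hasValue v k) (𝒢-stable w (os y arc)) })
        (λ { {_} {y} os (arc , _) → closed (os y arc) })
        x (options-wellFounded x) (options-wellFounded x)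

      -- If some option was unassigned, the label was kept, so the node was already assigned in `s`
      -- and `closed` applies.
      assigned-previous : ∀ {x} → Assigned′ x → OptionsAssigned x
      assigned-previous {x} as′@(w≢∞ , g≢∞) with OptionsAssigned? s x
      ... | yes os = os
      ... | no ¬os = by-colour {P = OptionsAssigned} x
        (λ w → closed (white-assigned s w (subst (_≢ ∞) (white-keep x w ¬os) (w≢∞ w))))
        (λ g → closed (gray-assigned s g (subst (_≢ ∞) (gray-keep x g ¬os) (g≢∞ g))))

      step-consistent : Consistent t
      step-consistent = record
        -- The option `y` was already assigned in `s`, hence so were its own options, and the step
        -- assigns `y` again.
        { closed       = λ as′ y arc →
            assigned-next (closed (assigned-previous as′ y arc))
        ; white-rule   = λ {x} w as′ →
            WhiteRule-resp (OptionNumbers-stable (assigned-previous as′))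
                           (white-assign x w (assigned-previous as′))
        ; gray-members = λ {x} g as′ →
            let os = assigned-previous as′
                to , from = members-set (gray-assign x g os)
            in (λ {k} m → trans (sym (Cr-stable k os)) (to m))
             , (λ {k} cr → from (trans (Cr-stable k os) cr))
        }

  labelling-consistent : ∀ {s} → IsLabelling s → ∀ n → Consistent (s n)
  labelling-consistent lab zero    = initial-consistent (IsLabelling.initial lab)
  labelling-consistent lab (suc n) =
    step-consistent (IsLabelling.step lab n) (labelling-consistent lab n)

  -- Numbers and exceptions coming from the options of a node.

  module _ {s : State V} (consistent : Consistent s) {x : Node}
           (os : State.OptionsAssigned s x) where
    open State s
    open Consistent consistent

    option-members : ∀ {y} → GrayOption x y → members (𝒞 y) ≐ CrTrue y
    option-members {y} (arc , g) = gray-members g (os y arc)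

    members? : ∀ {y} → GrayOption x y → Decidable (members (𝒞 y))
    members? {y} o k with option-members o
    ... | to , from = map′ from to (CrTrue? s y k)

    -- Turns the negative notion `Infinite` into a Boolean test at `threshold`: were the test false,
    -- the set would be bounded.
    infinite⇒tail : ∀ {y} → InfiniteGrayOption x y → CrTrue y (threshold s)
    infinite⇒tail {y} (o , inf) with CrTrue? s y (threshold s)
    ... | yes tail = tail
    ... | no ¬tail = contradiction
      (bounded⇒finite (members? o) (threshold s)
        (λ m → eventually-false s y ¬tail (proj₁ (option-members o) m)))
      inf

    tail⇒members : ∀ {y} → GrayOption x y → CrTrue y (threshold s) →
                   ∀ {k} → threshold s ≤ k → members (𝒞 y) k
    tail⇒members {y} o tail large =
      proj₂ (option-members o) (eventually-true s y tail large)

    InfiniteGrayOption? : ∀ y → Dec (InfiniteGrayOption x y)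
    InfiniteGrayOption? y = GrayOption? x y ×-dec′ λ o →
      map′ (λ tail → cobounded⇒infinite (threshold s) (tail⇒members o tail))
           (λ inf → infinite⇒tail (o , inf))
           (CrTrue? s y (threshold s))

    infinite⇒cofinite : ∀ y → InfiniteGrayOption x y → Cofinite (members (𝒞 y))
    infinite⇒cofinite y io@(o , _) =
      cobounded⇒cofinite (members? o) (threshold s) (tail⇒members o (infinite⇒tail io))

    -- The union of the finite complements `F_1`, ..., `F_j`, expressed without choosing lists for
    -- them.
    Exception : Pred ℕ 0ℓ
    Exception k = ∃ λ y → InfiniteGrayOption x y × ¬ members (𝒞 y) k

    Exception? : Decidable Exception
    Exception? k = any? λ y → InfiniteGrayOption? y ×-dec′ λ (o , _) → ¬? (members? o k)

    exception<threshold : ∀ {k} → Exception k → k < threshold s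
    exception<threshold {k} (y , io@(o , _) , ∉) with k <? threshold s
    ... | yes small = small
    ... | no ¬small = contradiction (tail⇒members o (infinite⇒tail io) (≮⇒≥ ¬small)) ∉

    -- A number outside all the complements lies in the set of the given infinite option, where `Cr`
    -- is then true; a single such gray option makes `Cr x k` false.
    non-exception⇒Cr-false : ∃ (InfiniteGrayOption x) → ∀ {k} → ¬ Exception k → Cr x k ≡ false
    non-exception⇒Cr-false (y , io@(o , _)) {k} ¬exc = ¬-not λ cr →
      false≢true (Cr-gray s cr o)
        (proj₁ (option-members o)
          (decidable-stable (members? o k) λ ∉ → ¬exc (y , io , ∉)))

    OptionNumbers? : Decidable (OptionNumbers x)
    OptionNumbers? k =
            any? (λ y → WhiteOption? x y ×-dec hasValue-dec (𝒢 y) k)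
      ⊎-dec any? (λ y → GrayOption? x y ×-dec′ λ o → members? o k)

    -- A gray option with `Cr` true at `threshold` would have an infinite set, so every gray set
    -- ends below `threshold`.
    optionNumber<threshold : ¬ ∃ (InfiniteGrayOption x) →
                             ∀ {k} → OptionNumbers x k → k < threshold s
    optionNumber<threshold none (inj₁ (y , _ , eq)) = value<threshold s eq
    optionNumber<threshold none (inj₂ (y , o , m)) = eventually-false s y
      (λ tail → none (y , o , cobounded⇒infinite (threshold s) (tail⇒members o tail)))
      (proj₁ (option-members o) m)

    non-optionNumber⇒Cr-true : ∀ {k} → ¬ OptionNumbers x k → CrTrue x k
    non-optionNumber⇒Cr-true ∉ = Cr-intro s
      (λ {y} o → ¬-not λ has → ∉ (inj₁ (y , o , hasValue-true (𝒢 y) has)))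
      (λ {y} o → ¬-not λ cr → ∉ (inj₂ (y , o , proj₂ (option-members o) cr)))

theorem1p14 : (V : AcyclicDigraph) (s : ℕ → State V) → IsLabelling s →
    let open AcyclicDigraph V in
    (n : ℕ) → let open State (s n) in
    (x : Node) → colour x ≡ gray → OptionsAssigned x →
    (Finite (CrTrue x) ⊎ (Infinite (CrTrue x) × Cofinite (CrTrue x)))
    × (∃ (InfiniteGrayOption x) →
    (∀ y → InfiniteGrayOption x y → Cofinite (members (𝒞 y)))
    × ∃ λ (l : ℤ) →
    IsMax (λ k → ∃ λ y → InfiniteGrayOption x y × ¬ members (𝒞 y) k) l
    × (∀ k → l <ℤ + k → Cr x k ≡ false))
    × (¬ ∃ (InfiniteGrayOption x) →
    ∃ λ (l : ℕ) →
    IsLeastExceeding (OptionNumbers x) l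
    × (∀ k → l ≤ k → Cr x k ≡ true))
theorem1p14 V s labelling n x _ os = CrTrue-finite⊎cofinite (s n) x , case₁ , case₂
  where
  consistent = labelling-consistent labelling n

  -- In both cases `threshold` serves only to bound the search; the `l` found is the exact extremal
  -- number.
  case₁ = λ some →
    let l , isMax , large = max-exists
          (empty⊎greatest (Exception? consistent os) _ (exception<threshold consistent os))
    in infinite⇒cofinite consistent os
     , l , isMax , λ k l<k → non-exception⇒Cr-false consistent os some (large k l<k)

  case₂ = λ none →
    let l , isLeast = leastExceeding-exists
          (empty⊎greatest (OptionNumbers? consistent os) _
                          (optionNumber<threshold consistent os none))
    in l , isLeast , λ k l≤k →
         non-optionNumber⇒Cr-true consistent os λ num → <⇒≱ (proj₁ isLeast k num) l≤k
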